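{- For every integer $n\geq 1$ we have $\phi(n)\leq n$.
   Context: Let $A$ be a finite alphabet with at least two letters. A word $w\in A^*$ is rich if it contains exactly $|w|+1$ distinct palindromic factors (contiguous subwords), including the empty word $\epsilon$. Let $R$ be the set of all rich words over $A$. A rich word $w$ can be extended in at least two ways if there are two distinct letters $x,y\in A$ such that $wx,wy\in R$. For $w\in R$, let $K(w)$ be the set of all words $u\in A^*$ such that $wu\in R$ and $wu$ can be extended in at least two ways (so $\epsilon\in K(w)$ if $w$ can be extended in at least two ways). Let $\omega(w)=\min\{|u| \mid u\in K(w)\}$, and for $n>0$ let $\phi(n)=\max\{\omega(w)\mid w\in R,\ |w|=n\}$. -}

module Defs where

open import Data.List using (List; length; reverse; _++_; _∷ʳ_)
open import Data.List.Membership.Propositional using (_∈_)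
open import Data.List.Relation.Binary.Infix.Heterogeneous using (Infix)
open import Data.List.Relation.Unary.Unique.Propositional using (Unique)
open import Data.Nat using (ℕ; suc; _≤_)
open import Data.Product using (∃-syntax; _×_)
open import Function.Bundles using (_⇔_)
open import Relation.Binary.PropositionalEquality using (_≡_; _≢_)
open import Relation.Unary using (Pred)

HasCardinality : ∀ {a p} {A : Set a} → Pred A p → ℕ → Set _
HasCardinality P n =
  ∃[ xs ] Unique xs × (∀ x → x ∈ xs ⇔ P x) × length xs ≡ n

IsMinimum : ∀ {p} → Pred ℕ p → ℕ → Set _
IsMinimum P m = P m × (∀ k → P k → m ≤ k)

module _ {a} {A : Set a} where

  Palindrome : List A → Set a
  Palindrome u = reverse u ≡ u

  Factor : List A → List A → Set a
  Factor = Infix _≡_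

  Rich : List A → Set a
  Rich w = HasCardinality (λ u → Factor u w × Palindrome u) (suc (length w))

  ExtendsInTwoWays : List A → Set a
  ExtendsInTwoWays w = ∃[ x ] ∃[ y ] x ≢ y × Rich (w ∷ʳ x) × Rich (w ∷ʳ y)

  K : List A → Pred (List A) a
  K w u = Rich (w ++ u) × ExtendsInTwoWays (w ++ u)

  -- ω and φ are given by their graphs, since neither the non-emptiness of
  -- K w nor the existence of the maximum is available at this point.
  -- ω[ w ]≡ k  reads "ω(w) is defined and equals k".
  ω[_]≡_ : List A → ℕ → Set a
  ω[ w ]≡ k = IsMinimum (λ l → ∃[ u ] K w u × length u ≡ l) k

-- φ[ A , n ]≡ m  reads "φ(n) over the alphabet A is defined and equals m".
-- The second component requires ω(w) to be defined for every rich w of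
-- length n; otherwise words with K w empty would be left out of the maximum.
φ[_,_]≡_ : ∀ {a} → Set a → ℕ → ℕ → Set a
φ[ A , n ]≡ m =
  (∃[ w ] Rich {A = A} w × length w ≡ n × ω[ w ]≡ m) ×
  (∀ (w : List A) → Rich w → length w ≡ n → ∃[ k ] ω[ w ]≡ k × k ≤ m)

-- A rich word ending in x s, with s a palindrome, and followed by y ≠ x can also be followed by x as
-- soon as x s x does not occur in it. If x s x does occur, let F run from the last occurrence of x s x,
-- without its first letter, to the end of the next x s. Then F is a palindrome longer than s, and it
-- too is preceded by x and followed by another letter.
--
-- Let n = |w|, let p be the palindromic closure of w, N = |p|, and let b > 0 be least such that p
-- without its first b letters is a palindrome. If b ≤ n, then p prolongs to a rich word of length
-- N + b with period b, so F can be moved by multiples of b until it ends at a position in [n, n + b);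
-- as its length increases, this stops, and it stops at a branching. If n < b, one descends inside
-- [n, N). When F ends too early, consider the palindrome S from the last s x to the final x s. If its
-- centre is that of p, the mirror image of F ends late enough. Otherwise S grows symmetrically until
-- the letters around it differ (a longer palindrome) or the end of p is reached; in the latter case
-- S lies in a palindromic suffix of p shorter than N - n, and its beginning is an earlier y s x.
module Submission where

open import Data.Empty using (⊥; ⊥-elim)
open import Data.Fin using (Fin)
import Data.Fin as Fin
import Data.Fin.Properties as Fin
open import Data.List using (List; []; _∷_; _++_; _∷ʳ_; length; reverse)
open import Data.List.Membership.Propositional using (_∈_)
open import Data.List.Membership.Propositional.Properties.WithK using (unique∧set⇒bag)
open import Data.List.Properties using (++-assoc; length-reverse; reverse-++; reverse-involutive; ∷-injective; unfold-reverse)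
open import Data.List.Relation.Binary.BagAndSetEquality using (∼bag⇒↭)
open import Data.List.Relation.Binary.Infix.Heterogeneous using (View; MkView; toView; fromView)
open import Data.List.Relation.Binary.Permutation.Propositional.Properties using (↭-length)
import Data.List.Relation.Binary.Pointwise as Pointwise
import Data.List.Relation.Unary.All as All
import Data.List.Relation.Unary.AllPairs as AllPairs
open import Data.List.Relation.Unary.Any using (here; there)
open import Data.Nat
open import Data.Nat.Properties
open import Data.Nat.Tactic.RingSolver using (solve)
open import Data.Product using (∃; ∃-syntax; _×_; _,_; proj₁; proj₂)
open import Data.Sum using (_⊎_; inj₁; inj₂)
open import Function.Base using (_∘_; _∋_; case_of_)
open import Function.Bundles using (_↔_; _⇔_; mk⇔; Equivalence; Inverse)
open import Function.Properties.Inverse using (↔⇒↣)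
open import Relation.Binary.Definitions using (DecidableEquality; tri<; tri≈; tri>)
open import Relation.Binary.PropositionalEquality
open import Relation.Nullary using (Dec; yes; no; ¬_; ¬?; _×-dec_; _→-dec_)
open import Relation.Nullary.Decidable using (map′; decidable-stable; via-injection)
open import Relation.Unary using (Decidable)
open import Defs

-- Arithmetic certificates and bounded search

infixr 6 _⊞_ _⊕_

_⊞_ : ∀ {a b c d} → a ≤ b → c ≤ d → a + c ≤ b + d
_⊞_ = +-mono-≤

_⊕_ : ∀ {a b c d : ℕ} → a ≡ b → c ≡ d → a + c ≡ b + d
_⊕_ = cong₂ _+_

-- Farkas certificates: S ≤ T is a sum of hypotheses, and K is the slack with which it entails the goal.
by-≤ : ∀ {L R S T} K → S ≤ T → L + T + K ≡ R + S → L ≤ R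
by-≤ {L} {R} {S} {T} K p q =
  +-cancelʳ-≤ S L R (≤-trans (+-monoʳ-≤ L p) (≤-trans (m≤m+n (L + T) K) (≤-reflexive q)))

by-⊥ : ∀ {S T} K → S ≤ T → T + suc K ≡ S → ⊥
by-⊥ {S} {T} K p q = m+1+n≰m T (≤-trans (≤-reflexive q) p)

by-≡ : ∀ {L R S T : ℕ} → S ≡ T → L + T ≡ R + S → L ≡ R
by-≡ {L} {R} {S} p q = +-cancelʳ-≡ S L R (trans (cong (L +_) p) q)

<⇒gap : ∀ {k l} → k < l → ∃[ m ] suc (k + m) ≡ l
<⇒gap k<l = m≤n⇒∃[o]m+o≡n k<l

Greatest : ∀ {p} → (ℕ → Set p) → ℕ → ℕ → Set p
Greatest P b m = m < b × P m × (∀ k → m < k → k < b → ¬ P k)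

greatest : ∀ {p} {P : ℕ → Set p} → Decidable P → ∀ b {c} → c < b → P c → ∃ (Greatest P b)
greatest P? (suc b) {c} c<b Pc with P? b
... | yes Pb = b , ≤-refl , Pb , λ k b<k k<sb _ → <-irrefl refl (≤-trans b<k (s≤s⁻¹ k<sb))
... | no ¬Pb with m≤n⇒m<n∨m≡n (s≤s⁻¹ c<b)
...   | inj₂ refl = ⊥-elim (¬Pb Pc)
...   | inj₁ c<b′ with greatest P? b c<b′ Pc
...     | m , m<b , Pm , max = m , m<n⇒m<1+n m<b , Pm , λ k m<k k<sb →
          case m≤n⇒m<n∨m≡n (s≤s⁻¹ k<sb) of λ where
            (inj₁ k<b)  → max k m<k k<b
            (inj₂ refl) → ¬Pb

Least : ∀ {p} → (ℕ → Set p) → ℕ → ℕ → Set p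
Least P b m = m ≤ b × P m × (∀ k → k < m → ¬ P k)

least : ∀ {p} {P : ℕ → Set p} → Decidable P → ∀ b → P b → ∃ (Least P b)
least P? zero Pb = 0 , z≤n , Pb , λ _ ()
least P? (suc b) Pb with P? 0
... | yes P0 = 0 , z≤n , P0 , λ _ ()
... | no ¬P0 with least (P? ∘ suc) b Pb
...   | m , m≤b , Pm , min = suc m , s≤s m≤b , Pm , λ where
          zero    _         → ¬P0
          (suc k) (s≤s k<m) → min k k<m

-- Words as functions on positions

module _ {a} {A : Set a} where

  -- A word of length n is given by a function on ℕ of which only the values below n matter;
  -- an interval [s, e) of positions stands for a factor.
  Pal : (ℕ → A) → ℕ → ℕ → Set a
  Pal f s e = ∀ i k → s ≤ i → s ≤ k → suc (i + k) ≡ s + e → f i ≡ f k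

  Occ : (ℕ → A) → ℕ → ℕ → ℕ → Set a
  Occ f c s l = ∀ k → k < l → f (c + k) ≡ f (s + k)

  Fresh : (ℕ → A) → ℕ → ℕ → Set a
  Fresh f s e = ∀ c l → c < s → s + l ≡ e → ¬ Occ f c s l

  -- Appending a letter creates at most one new palindrome, necessarily a suffix; here the letter at
  -- position `n` does create one.
  New : (ℕ → A) → ℕ → Set a
  New f n = ∃[ s ] s ≤ n × Pal f s (suc n) × Fresh f s (suc n)

  -- The classical criterion for the prefix of length `n` to be rich; the equivalence rests on
  -- `count`.
  AllNew : (ℕ → A) → ℕ → Set a
  AllNew f n = ∀ i → i < n → New f i

  -- Factors as lists and as intervals

  fw : (ℕ → A) → ℕ → ℕ → List A
  fw f s zero    = []
  fw f s (suc l) = f s ∷ fw f (suc s) l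

  length-fw : ∀ f s l → length (fw f s l) ≡ l
  length-fw f s zero    = refl
  length-fw f s (suc l) = cong suc (length-fw f (suc s) l)

  fw-++ : ∀ f s l m → fw f s (l + m) ≡ fw f s l ++ fw f (s + l) m
  fw-++ f s zero    m = cong (λ t → fw f t m) (sym (+-identityʳ s))
  fw-++ f s (suc l) m =
    cong (f s ∷_) (trans (fw-++ f (suc s) l m) (cong (λ t → fw f (suc s) l ++ fw f t m) (sym (+-suc s l))))

  fw-∷ʳ : ∀ f s l → fw f s (suc l) ≡ fw f s l ∷ʳ f (s + l)
  fw-∷ʳ f s l = trans (cong (fw f s) (+-comm 1 l)) (fw-++ f s l 1)

  fw-cong : ∀ f g s t l → (∀ k → k < l → f (s + k) ≡ g (t + k)) → fw f s l ≡ fw g t l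
  fw-cong f g s t zero    eq = refl
  fw-cong f g s t (suc l) eq = cong₂ _∷_
    (subst₂ (λ i j → f i ≡ g j) (+-identityʳ s) (+-identityʳ t) (eq 0 z<s))
    (fw-cong f g (suc s) (suc t) l λ k k<l →
      subst₂ (λ i j → f i ≡ g j) (+-suc s k) (+-suc t k) (eq (suc k) (s<s k<l)))

  fw-injective : ∀ f g s t l → fw f s l ≡ fw g t l → ∀ k → k < l → f (s + k) ≡ g (t + k)
  fw-injective f g s t (suc l) eq zero    _         =
    subst₂ (λ i j → f i ≡ g j) (sym (+-identityʳ s)) (sym (+-identityʳ t)) (proj₁ (∷-injective eq))
  fw-injective f g s t (suc l) eq (suc k) (s<s k<l) =
    subst₂ (λ i j → f i ≡ g j) (sym (+-suc s k)) (sym (+-suc t k))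
      (fw-injective f g (suc s) (suc t) l (proj₂ (∷-injective eq)) k k<l)

  fw-reverse : ∀ f g s t l → (∀ i k → suc (i + k) ≡ l → g (t + i) ≡ f (s + k)) →
               reverse (fw f s l) ≡ fw g t l
  fw-reverse f g s t zero    eq = refl
  fw-reverse f g s t (suc l) eq = begin
    reverse (f s ∷ fw f (suc s) l)      ≡⟨ unfold-reverse (f s) (fw f (suc s) l) ⟩
    reverse (fw f (suc s) l) ∷ʳ f s     ≡⟨ cong₂ _∷ʳ_ (fw-reverse f g (suc s) t l step) last ⟩
    fw g t l ∷ʳ g (t + l)               ≡⟨ fw-∷ʳ g t l ⟨
    fw g t (suc l)                      ∎
    where
    open ≡-Reasoning
    step : ∀ i k → suc (i + k) ≡ l → g (t + i) ≡ f (suc s + k)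
    step i k ik = trans (eq i (suc k) (cong suc (trans (+-suc i k) ik))) (cong f (+-suc s k))
    last : f s ≡ g (t + l)
    last = trans (cong f (sym (+-identityʳ s))) (sym (eq l 0 (cong suc (+-identityʳ l))))

  Pal⇒palindrome : ∀ f s l → Pal f s (s + l) → Palindrome (fw f s l)
  Pal⇒palindrome f s l pal = fw-reverse f f s s l λ i k ik →
    pal (s + i) (s + k) (m≤m+n s i) (m≤m+n s k) (by-≡ {suc (s + i + (s + k))} {s + (s + l)} ik (solve (i ∷ k ∷ l ∷ s ∷ [])))

  palindrome⇒Pal : ∀ f s l → Palindrome (fw f s l) → Pal f s (s + l)
  palindrome⇒Pal f s l pal i k s≤i s≤k ik
    with i′ , refl ← m≤n⇒∃[o]m+o≡n s≤i
       | k′ , refl ← m≤n⇒∃[o]m+o≡n s≤k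
    with refl ← (l ≡ suc (i′ + k′)) ∋ (by-≡ {l} {suc (i′ + k′)} (sym ik) (solve (i′ ∷ k′ ∷ l ∷ s ∷ []))) = begin
      f (s + i′)                          ≡⟨ fw-injective f mirror s 0 l (trans (sym pal) rev) i′ (s≤s (m≤m+n i′ k′)) ⟩
      mirror i′                           ≡⟨ cong (λ j → f (s + j)) (m+n∸m≡n i′ k′) ⟩
      f (s + k′)                          ∎
    where
    open ≡-Reasoning
    mirror : ℕ → A
    mirror j = f (s + (l ∸ suc j))
    rev : reverse (fw f s l) ≡ fw mirror 0 l
    rev = fw-reverse f mirror s 0 l λ i k ik →
      cong (λ j → f (s + j)) (trans (cong (_∸ suc i) (sym ik)) (m+n∸m≡n i k))

  fw-split : ∀ xs {ys} f s n → xs ++ ys ≡ fw f s n →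
             ∃[ m ] length xs + m ≡ n × xs ≡ fw f s (length xs) × ys ≡ fw f (s + length xs) m
  fw-split []       f s n       eq = n , refl , refl , trans eq (cong (λ t → fw f t n) (sym (+-identityʳ s)))
  fw-split (x ∷ xs) f s (suc n) eq with ∷-injective eq
  ... | refl , eq′ with fw-split xs f (suc s) n eq′
  ...   | m , refl , xs≡ , ys≡ =
    m , refl , cong (x ∷_) xs≡ , trans ys≡ (cong (λ t → fw f t m) (sym (+-suc s (length xs))))

  PalFactor : (ℕ → A) → ℕ → List A → Set a
  PalFactor f n u = ∃[ s ] ∃[ l ] s + l ≤ n × Pal f s (s + l) × u ≡ fw f s l

  PalindromicFactor : List A → List A → Set a
  PalindromicFactor w u = Factor u w × Palindrome u

  PalFactor⇒factor : ∀ f n u → PalFactor f n u → PalindromicFactor (fw f 0 n) u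
  PalFactor⇒factor f n u (s , l , s+l≤n , pal , refl)
    with m , refl ← m≤n⇒∃[o]m+o≡n s+l≤n =
      subst (Factor (fw f s l)) (sym split) (fromView (MkView (fw f 0 s) (Pointwise.refl refl) (fw f (s + l) m)))
    , Pal⇒palindrome f s l pal
    where
    split : fw f 0 (s + l + m) ≡ fw f 0 s ++ fw f s l ++ fw f (s + l) m
    split = trans (cong (fw f 0) (+-assoc s l m)) (trans (fw-++ f 0 s (l + m)) (cong (fw f 0 s ++_) (fw-++ f s l m)))

  factor⇒PalFactor : ∀ f n u → PalindromicFactor (fw f 0 n) u → PalFactor f n u
  factor⇒PalFactor f n u (inf , pal) = go (toView inf) refl
    where
    go : ∀ {w} → View _≡_ u w → w ≡ fw f 0 n → PalFactor f n u
    go (MkView pref u≈ suff) eq with refl ← Pointwise.Pointwise-≡⇒≡ u≈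
      with m , refl , _ , eq′ ← fw-split pref f 0 n eq
      with m′ , refl , u≡ , _ ← fw-split u f (length pref) m eq′ =
        length pref , length u , +-monoʳ-≤ (length pref) (m≤m+n (length u) m′)
      , palindrome⇒Pal f (length pref) (length u) (subst Palindrome u≡ pal) , u≡

  -- Reflection in the palindrome `[s, e)` moves its suffix `[t, e)` to the front, where it reads
  -- the same because it is itself a palindrome.
  Pal-suffix-Occ : ∀ f {s t e l} → Pal f s e → Pal f t e → s ≤ t → t + l ≡ e → Occ f s t l
  Pal-suffix-Occ f {s} {t} {e} {l} ps pt s≤t tl k k<l with m , eq ← <⇒gap k<l = trans
    (ps (s + k) (t + m) (m≤m+n s k) (m≤n⇒m≤n+o m s≤t)
      (by-≡ {suc (s + k + (t + m))} {s + e} (eq ⊕ tl) (solve (e ∷ k ∷ l ∷ m ∷ s ∷ t ∷ []))))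
    (pt (t + m) (t + k) (m≤m+n t m) (m≤m+n t k)
      (by-≡ {suc (t + m + (t + k))} {t + e} (eq ⊕ tl) (solve (e ∷ k ∷ l ∷ m ∷ t ∷ []))))

  HasCardinality-cong : ∀ {p q} {P : List A → Set p} {Q : List A → Set q} {n} →
    (∀ u → P u → Q u) → (∀ u → Q u → P u) → HasCardinality P n → HasCardinality Q n
  HasCardinality-cong P⇒Q Q⇒P (xs , uniq , mem , len) =
    xs , uniq , (λ u → mk⇔ (P⇒Q u ∘ Equivalence.to (mem u)) (Equivalence.from (mem u) ∘ Q⇒P u)) , len

  -- Two duplicate-free enumerations of the same set are permutations of each other.
  HasCardinality-unique : ∀ {p} {P : List A → Set p} {m n} → HasCardinality P m → HasCardinality P n → m ≡ n
  HasCardinality-unique (xs , ux , memx , refl) (ys , uy , memy , refl) =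
    ↭-length (∼bag⇒↭ (unique∧set⇒bag ux uy λ {u} →
      mk⇔ (Equivalence.from (memy u) ∘ Equivalence.to (memx u))
          (Equivalence.from (memx u) ∘ Equivalence.to (memy u))))

-- Richness and new palindromic suffixes

module Words {a} {A : Set a} (_≟ᴬ_ : DecidableEquality A) where

  Pal? : ∀ f s e → Dec (Pal {A = A} f s e)
  Pal? f s e = map′
    (λ all i k s≤i s≤k eq → all {i} (by-≤ 0 (≤-reflexive eq ⊞ s≤k) (solve (e ∷ i ∷ k ∷ s ∷ [])))
                                {k} (by-≤ 0 (≤-reflexive eq ⊞ s≤i) (solve (e ∷ i ∷ k ∷ s ∷ []))) s≤i s≤k eq)
    (λ pal {i} _ {k} _ → pal i k)
    (allUpTo? (λ i → allUpTo? (λ k → (s ≤? i) →-dec (s ≤? k) →-dec (suc (i + k) ≟ s + e) →-dec (f i ≟ᴬ f k)) e) e)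

  Occ? : ∀ f c s l → Dec (Occ {A = A} f c s l)
  Occ? f c s l = map′ (λ all k → all {k}) (λ occ {k} → occ k) (allUpTo? (λ k → f (c + k) ≟ᴬ f (s + k)) l)

  Fresh? : ∀ f s e → Dec (Fresh {A = A} f s e)
  Fresh? f s e = map′
    (λ all c l c<s eq → all {c} c<s {l} (s≤s (m+n≤o⇒n≤o s (≤-reflexive eq))) eq)
    (λ fresh {c} c<s {l} _ → fresh c l c<s)
    (allUpTo? (λ c → allUpTo? (λ l → (s + l ≟ e) →-dec ¬? (Occ? f c s l)) (suc e)) s)

  New? : ∀ (f : ℕ → A) n → Dec (New f n)
  New? f n = map′
    (λ (s , s<sn , new) → s , s≤s⁻¹ s<sn , new)
    (λ (s , s≤n , new) → s , s≤s s≤n , new)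
    (anyUpTo? (λ s → Pal? f s (suc n) ×-dec Fresh? f s (suc n)) (suc n))

  AllNew? : ∀ (f : ℕ → A) n → Dec (AllNew f n)
  AllNew? f n = map′ (λ all i → all {i}) (λ all {i} → all i) (allUpTo? (New? f) n)

  ¬Fresh⇒Occ : ∀ {f : ℕ → A} {s e} → ¬ Fresh f s e → ∃[ c ] ∃[ l ] c < s × s + l ≡ e × Occ f c s l
  ¬Fresh⇒Occ {f} {s} {e} ¬fresh with s ≤? e
  ... | no s≰e = ⊥-elim (¬fresh λ c l _ eq _ → s≰e (subst (s ≤_) eq (m≤m+n s l)))
  ... | yes s≤e with m≤n⇒∃[o]m+o≡n s≤e
  ...   | l , refl with anyUpTo? (λ c → Occ? f c s l) s
  ...     | yes (c , c<s , occ) = c , l , c<s , refl , occ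
  ...     | no ¬any = ⊥-elim (¬fresh λ c l′ c<s eq occ →
              ¬any (c , c<s , subst (Occ f c s) (+-cancelˡ-≡ s l′ l eq) occ))

  PalFactor-mono : ∀ {f : ℕ → A} {n u} → PalFactor f n u → PalFactor f (suc n) u
  PalFactor-mono (s , l , s+l≤n , rest) = s , l , m≤n⇒m≤1+n s+l≤n , rest

  PalFactor-Occ : ∀ {f : ℕ → A} {n c s l} → c < s → s + l ≡ suc n → Pal f s (suc n) → Occ f c s l →
                  PalFactor f n (fw f s l)
  PalFactor-Occ {f} {n} {c} {s} {l} c<s eq pal occ =
    c , l , (by-≤ 0 (c<s ⊞ ≤-reflexive eq) (solve (c ∷ l ∷ n ∷ s ∷ [])))
      , palindrome⇒Pal f c l (subst Palindrome (sym same) (Pal⇒palindrome f s l (subst (Pal f s) (sym eq) pal)))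
      , sym same
    where
    same : fw f c l ≡ fw f s l
    same = fw-cong f f c s l occ

  -- A palindromic suffix of the prefix of length 1 + n is the new one, or occurs inside it as a proper
  -- suffix and hence also as a prefix, or is empty.
  PalFactor-suc : ∀ {f : ℕ → A} {n s l u} → s + l ≡ suc n → Pal f s (suc n) → Fresh f s (suc n) →
                  PalFactor f (suc n) u → u ≡ fw f s l ⊎ PalFactor f n u
  PalFactor-suc {f} {n} {s} {l} eq pal fresh (t , m , t+m≤ , palt , refl) with m≤n⇒m<n∨m≡n t+m≤
  ... | inj₁ t+m<  = inj₂ (t , m , s≤s⁻¹ t+m< , palt , refl)
  ... | inj₂ t+m≡ with <-cmp s t
  ...   | tri< s<t _ _  = inj₂ (PalFactor-Occ s<t t+m≡ palt′ (Pal-suffix-Occ f pal palt′ (<⇒≤ s<t) t+m≡))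
    where palt′ = subst (Pal f t) t+m≡ palt
  ...   | tri≈ _ refl _ = inj₁ (cong (fw f s) (+-cancelˡ-≡ s m l (trans t+m≡ (sym eq))))
  ...   | tri> _ _ t<s  = ⊥-elim (fresh t l t<s eq (Pal-suffix-Occ f (subst (Pal f t) t+m≡ palt) pal (<⇒≤ t<s) eq))

  Pal-empty : ∀ (f : ℕ → A) s → Pal f s s
  Pal-empty f s i k s≤i s≤k eq =
    ⊥-elim (by-⊥ 0 (s≤i ⊞ s≤k ⊞ ≤-reflexive eq) (solve (i ∷ k ∷ s ∷ [])))

  -- By induction, position `n` adds one palindromic factor if `New f n` holds and none otherwise,
  -- so the upper bound is reached exactly when every position contributes.
  count : ∀ f n → ∃[ c ] HasCardinality (PalFactor f n) c × c ≤ suc n ×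
          (c ≡ suc n → AllNew f n) × (AllNew f n → c ≡ suc n)
  count f zero = 1 , ([] ∷ [] , All.[] AllPairs.∷ AllPairs.[] , mem , refl) , ≤-refl , (λ _ _ ()) , λ _ → refl
    where
    mem : ∀ u → (u ∈ [] ∷ []) ⇔ PalFactor f 0 u
    mem u = mk⇔ (λ { (here refl) → 0 , 0 , z≤n , Pal-empty f 0 , refl })
                (λ { (zero , zero , _ , _ , refl) → here refl })
  count f (suc n) with count f n | New? f n
  ... | c , (xs , uniq , mem , len) , c≤ , full⇒ , ⇒full | no ¬new =
        c , (xs , uniq , (λ u → mk⇔ (PalFactor-mono ∘ Equivalence.to (mem u)) (Equivalence.from (mem u) ∘ old u)) , len)
      , m≤n⇒m≤1+n c≤ , (λ { refl → ⊥-elim (1+n≰n c≤) }) , λ all → ⊥-elim (¬new (all n ≤-refl))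
    where
    old : ∀ u → PalFactor f (suc n) u → PalFactor f n u
    old u (t , m , t+m≤ , palt , refl) with m≤n⇒m<n∨m≡n t+m≤
    old u (t , m , t+m≤ , palt , refl) | inj₁ t+m< = t , m , s≤s⁻¹ t+m< , palt , refl
    -- The empty suffix begins at `suc n`, outside the range of `New`, and is relocated to `0`.
    old u (t , zero , t+m≤ , palt , refl) | inj₂ t+m≡ = 0 , 0 , z≤n , Pal-empty f 0 , refl
    old u (t , suc m , t+m≤ , palt , refl) | inj₂ t+m≡
      with palt′ ← subst (Pal f t) t+m≡ palt
      with c , l , c<t , t+l≡ , occ ← ¬Fresh⇒Occ {f} (λ fresh →
             ¬new (t , (by-≤ m (≤-reflexive t+m≡) (solve (m ∷ n ∷ t ∷ []))) , palt′ , fresh))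
      = subst (λ m → PalFactor f n (fw f t m)) (+-cancelˡ-≡ t l (suc m) (trans t+l≡ (sym t+m≡)))
          (PalFactor-Occ c<t t+l≡ palt′ occ)
  ... | c , (xs , uniq , mem , len) , c≤ , full⇒ , ⇒full | yes (s , s≤n , pal , fresh)
    with l , s+l≡ ← m≤n⇒∃[o]m+o≡n (m≤n⇒m≤1+n s≤n) =
        suc c , (new ∷ xs , All.tabulate (λ {u} u∈ → λ { refl → notOld (Equivalence.to (mem u) u∈) }) AllPairs.∷ uniq , mem′ , cong suc len)
      , s≤s c≤
      , (λ full i i<sn → case m≤n⇒m<n∨m≡n (s≤s⁻¹ i<sn) of λ where
           (inj₁ i<n)  → full⇒ (suc-injective full) i i<n
           (inj₂ refl) → s , s≤n , pal , fresh)
      , λ all → cong suc (⇒full λ i i<n → all i (m<n⇒m<1+n i<n))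
    where
    new : List A
    new = fw f s l
    -- A copy within the first `n` letters has the same length, so it starts before `s`, against
    -- freshness.
    notOld : ¬ PalFactor f n new
    notOld (t , m , t+m≤n , _ , eq)
      with refl ← trans (sym (length-fw f s l)) (trans (cong length eq) (length-fw f t m)) =
      fresh t l (by-≤ 0 (t+m≤n ⊞ ≤-reflexive (sym s+l≡)) (solve (l ∷ n ∷ s ∷ t ∷ []))) s+l≡ (fw-injective f f t s l (sym eq))
    mem′ : ∀ u → (u ∈ new ∷ xs) ⇔ PalFactor f (suc n) u
    mem′ u = mk⇔
      (λ { (here refl) → s , l , ≤-reflexive s+l≡ , subst (Pal f s) (sym s+l≡) pal , refl
         ; (there u∈)  → PalFactor-mono (Equivalence.to (mem u) u∈) })
      (λ pf → case PalFactor-suc s+l≡ pal fresh pf of λ where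
        (inj₁ refl) → here refl
        (inj₂ old)  → there (Equivalence.from (mem u) old))

  Rich⇒AllNew : ∀ f n → Rich (fw f 0 n) → AllNew f n
  Rich⇒AllNew f n rich with c , card , _ , full⇒ , _ ← count f n =
    full⇒ (HasCardinality-unique card (HasCardinality-cong (factor⇒PalFactor f n) (PalFactor⇒factor f n)
      (subst (HasCardinality (PalindromicFactor (fw f 0 n)) ∘ suc) (length-fw f 0 n) rich)))

  AllNew⇒Rich : ∀ f n → AllNew f n → Rich (fw f 0 n)
  AllNew⇒Rich f n all with c , card , _ , _ , ⇒full ← count f n =
    HasCardinality-cong (PalFactor⇒factor f n) (factor⇒PalFactor f n)
      (subst (HasCardinality _) (trans (⇒full all) (cong suc (sym (length-fw f 0 n)))) card)

  -- Reversal and suffixes of rich words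

  -- A palindromic factor is its own reversal, so a word and its reversal have the same palindromic
  -- factors.
  Rich-reverse : ∀ {w : List A} → Rich w → Rich (reverse w)
  Rich-reverse {w} rich = subst (HasCardinality (PalindromicFactor (reverse w)) ∘ suc) (sym (length-reverse w))
    (HasCardinality-cong (λ u (inf , pal) → subst (λ v → Factor v (reverse w)) pal (reverse-Factor inf) , pal)
      (λ u (inf , pal) → subst₂ Factor pal (reverse-involutive w) (reverse-Factor inf) , pal) rich)
    where
    reverse-Factor : ∀ {u v : List A} → Factor u v → Factor (reverse u) (reverse v)
    reverse-Factor {u} inf with MkView pref u≈ suff ← toView inf
      with refl ← Pointwise.Pointwise-≡⇒≡ u≈ =
      subst (Factor (reverse u)) (sym eq) (fromView (MkView (reverse suff) (Pointwise.refl refl) (reverse pref)))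
      where
      eq : reverse (pref ++ u ++ suff) ≡ reverse suff ++ reverse u ++ reverse pref
      eq = trans (reverse-++ pref (u ++ suff)) (trans (cong (_++ reverse pref) (reverse-++ u suff))
             (++-assoc (reverse suff) (reverse u) (reverse pref)))

  -- `AllNew` reads prefixes from the left and is not visibly symmetric; the passage through `Rich`
  -- supplies the symmetry.
  AllNew-reflect : ∀ {f g : ℕ → A} {n} → (∀ i k → suc (i + k) ≡ n → g i ≡ f k) → AllNew f n → AllNew g n
  AllNew-reflect {f} {g} {n} mirror all = Rich⇒AllNew g n
    (subst Rich (fw-reverse f g 0 0 n mirror) (Rich-reverse (AllNew⇒Rich f n all)))

  -- Prefixes inherit `AllNew` at once; two reflections carry this over to suffixes.
  AllNew-drop : ∀ {f : ℕ → A} b {n} → AllNew f (b + n) → AllNew (λ i → f (b + i)) n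
  AllNew-drop {f} b {n} all = AllNew-reflect back (λ i i<n → AllNew-reflect {f} {g} there′ all i (≤-trans i<n (m≤n+m n b)))
    where
    g : ℕ → A
    g i = f (b + n ∸ suc i)
    there′ : ∀ i k → suc (i + k) ≡ b + n → g i ≡ f k
    there′ i k eq = cong f (trans (cong (_∸ suc i) (sym eq)) (m+n∸m≡n i k))
    back : ∀ i k → suc (i + k) ≡ n → f (b + i) ≡ g k
    back i k eq = sym (there′ k (b + i) (by-≡ {suc (k + (b + i))} {b + n} eq (solve (b ∷ i ∷ k ∷ n ∷ []))))

  AllNew-≤ : ∀ {f : ℕ → A} {m n} → m ≤ n → AllNew f n → AllNew f m
  AllNew-≤ m≤n all i i<m = all i (≤-trans i<m m≤n)

  -- Transfer between agreeing words; complete returns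

  Pal-cong : ∀ {f g : ℕ → A} {s e} → (∀ k → k < e → g k ≡ f k) → Pal f s e → Pal g s e
  Pal-cong {s = s} {e} g≡f pal i k s≤i s≤k eq = trans
    (g≡f i (by-≤ 0 (≤-reflexive eq ⊞ s≤k) (solve (e ∷ i ∷ k ∷ s ∷ []))))
    (trans (pal i k s≤i s≤k eq) (sym (g≡f k (by-≤ 0 (≤-reflexive eq ⊞ s≤i) (solve (e ∷ i ∷ k ∷ s ∷ []))))))

  Occ-cong : ∀ {f g : ℕ → A} {c s l e} → (∀ k → k < e → g k ≡ f k) → c ≤ s → s + l ≤ e → Occ f c s l → Occ g c s l
  Occ-cong {c = c} {s} g≡f c≤s s+l≤e occ k k<l = trans (g≡f (c + k) (≤-<-trans (+-monoˡ-≤ k c≤s) s+k<e))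
      (trans (occ k k<l) (sym (g≡f (s + k) s+k<e)))
    where s+k<e = <-≤-trans (+-monoʳ-< s k<l) s+l≤e

  New-cong : ∀ {f g : ℕ → A} {n} → (∀ k → k < suc n → g k ≡ f k) → New f n → New g n
  New-cong g≡f (s , s≤n , pal , fresh) = s , s≤n , Pal-cong g≡f pal , λ c l c<s eq occ →
    fresh c l c<s eq (Occ-cong (λ k k<e → sym (g≡f k k<e)) (<⇒≤ c<s) (≤-reflexive eq) occ)

  Pal-∷ : ∀ {f : ℕ → A} {s e} → f s ≡ f e → Pal f (suc s) e → Pal f s (suc e)
  Pal-∷ {f} {s} {e} fs≡fe pal i k s≤i s≤k eq with m≤n⇒m<n∨m≡n s≤i | m≤n⇒m<n∨m≡n s≤k
  ... | inj₂ refl | _         = trans fs≡fe (cong f (by-≡ {e} {k} (sym eq) (solve (e ∷ k ∷ s ∷ []))))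
  ... | inj₁ _    | inj₂ refl = trans (cong f (by-≡ {i} {e} eq (solve (e ∷ i ∷ s ∷ [])))) (sym fs≡fe)
  ... | inj₁ s<i  | inj₁ s<k  = pal i k s<i s<k (trans eq (+-suc s e))

  -- A new palindromic suffix starting after 0 would either be short, and then occur at 0 as well, or
  -- begin with a second occurrence of the prefix of length m.
  return₀ : ∀ {f : ℕ → A} {e m} → AllNew f e →
            (∀ i k → k < m → suc (i + k) ≡ e → f i ≡ f k) →
            (∀ c → 0 < c → c + m < e → ¬ Occ f 0 c m) → Pal f 0 e
  return₀ {f} {zero} _ _ _ = Pal-empty f 0
  return₀ {f} {suc n} {m} all mirror none with all n ≤-refl
  ... | zero , _ , pal , _ = pal
  ... | suc s , s<n , pal , fresh with l , s+l≡ ← m≤n⇒∃[o]m+o≡n (m≤n⇒m≤1+n s<n) = ⊥-elim contra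
    where
    occ : ∀ k → k < l → k < m → f k ≡ f (suc s + k)
    occ k k<l k<m with p , eq ← <⇒gap k<l = trans
      (sym (mirror (suc s + p) k k<m (by-≡ {suc (suc s + p + k)} {suc n} (eq ⊕ s+l≡) (solve (k ∷ l ∷ n ∷ p ∷ s ∷ [])))))
      (pal (suc s + p) (suc s + k) (m≤m+n (suc s) p) (m≤m+n (suc s) k)
        (by-≡ {suc (suc s + p + (suc s + k))} {suc s + suc n} (eq ⊕ s+l≡) (solve (k ∷ l ∷ n ∷ p ∷ s ∷ []))))
    contra : ⊥
    contra with l ≤? m
    ... | yes l≤m = fresh 0 l z<s s+l≡ λ k k<l → occ k k<l (<-≤-trans k<l l≤m)
    ... | no l≰m = none (suc s) z<s (subst (suc s + m <_) s+l≡ (+-monoʳ-< (suc s) (≰⇒> l≰m)))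
                     λ k k<m → occ k (<-trans k<m (≰⇒> l≰m)) k<m

  Pal-shift : ∀ {f : ℕ → A} b {E} → (∀ i k → suc (i + k) ≡ E → f (b + i) ≡ f (b + k)) → Pal f b (b + E)
  Pal-shift b {E} pal i k b≤i b≤k eq
    with i′ , refl ← m≤n⇒∃[o]m+o≡n b≤i
       | k′ , refl ← m≤n⇒∃[o]m+o≡n b≤k =
    pal i′ k′ (by-≡ {suc (i′ + k′)} {E} eq (solve (E ∷ b ∷ i′ ∷ k′ ∷ [])))

  -- The letters from `b` on form a rich word by `AllNew-drop`, so `return₀` applies to the
  -- interval.
  return-prefix : ∀ {f : ℕ → A} b {E m} → AllNew f (b + E) →
                  (∀ i k → k < m → suc (i + k) ≡ E → f (b + i) ≡ f (b + k)) →
                  (∀ c → 0 < c → c + m < E → ¬ Occ f b (b + c) m) → Pal f b (b + E)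
  return-prefix {f} b all mirror none = Pal-shift b λ i k →
    return₀ (AllNew-drop b all) mirror
      (λ c 0<c c+m<E occ → none c 0<c c+m<E λ j j<m → trans (occ j j<m) (cong f (sym (+-assoc b c j))))
      i k z≤n z≤n

  -- The mirror image of `return-prefix`, obtained by reading the interval backwards: here it is the
  -- suffix that must not recur inside.
  return-suffix : ∀ {f : ℕ → A} b {t m} → AllNew f (b + (t + m)) →
                  (∀ i k → k < m → suc (i + k) ≡ t + m → f (b + i) ≡ f (b + k)) →
                  (∀ c → 0 < c → c < t → ¬ Occ f (b + c) (b + t) m) → Pal f b (b + (t + m))
  return-suffix {f} b {t} {m} all mirror none = Pal-shift b λ i k eq → begin
      f (b + i)  ≡⟨ back k i (trans (cong suc (+-comm k i)) eq) ⟨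
      g k        ≡⟨ pal i k z≤n z≤n eq ⟨
      g i        ≡⟨ back i k eq ⟩
      f (b + k)  ∎
    where
    open ≡-Reasoning
    g : ℕ → A
    g i = f (b + (t + m ∸ suc i))
    back : ∀ i k → suc (i + k) ≡ t + m → g i ≡ f (b + k)
    back i k eq = cong (λ j → f (b + j)) (trans (cong (_∸ suc i) (sym eq)) (m+n∸m≡n i k))
    pal : Pal g 0 (t + m)
    pal = return₀ (AllNew-reflect back (AllNew-drop b all))
      (λ i k k<m eq → trans (back i k eq) (trans (sym (mirror i k k<m eq)) (sym (back k i (trans (cong suc (+-comm k i)) eq)))))
      λ c 0<c c+m<E occ → case <⇒gap (+-cancelʳ-< m c t c+m<E) of λ where
        (c′ , refl) → none (suc c′) z<s (by-≤ 0 0<c (solve (c ∷ c′ ∷ []))) λ k k<m → case <⇒gap k<m of λ where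
          (p , refl) → begin
            f (b + suc c′ + k)       ≡⟨ cong f (+-assoc b (suc c′) k) ⟩
            f (b + (suc c′ + k))     ≡⟨ back (c + p) (suc c′ + k) ((suc (c + p + (suc c′ + k)) ≡ suc (c + c′) + suc (k + p)) ∋ solve (c ∷ c′ ∷ k ∷ p ∷ [])) ⟨
            g (c + p)                ≡⟨ occ p (s≤s (m≤n+m p k)) ⟨
            g p                      ≡⟨ back p (suc (c + c′) + k) ((suc (p + (suc (c + c′) + k)) ≡ suc (c + c′) + suc (k + p)) ∋ solve (c ∷ c′ ∷ k ∷ p ∷ [])) ⟩
            f (b + (suc (c + c′) + k)) ≡⟨ cong f (+-assoc b (suc (c + c′)) k) ⟨
            f (b + suc (c + c′) + k) ∎

  -- Failing extensions and branchings

  -- With x = f a, s = f[a+1 .. a+l] and y = f(a+l+1): s is a palindrome and x ≠ y.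
  Fail : (ℕ → A) → ℕ → ℕ → Set a
  Fail f a l = Pal f (suc a) (a + suc l) × f a ≢ f (a + suc l)

  -- The word x s x occurs at d.
  Loop : (ℕ → A) → ℕ → ℕ → ℕ → Set a
  Loop f a l d = Occ f d a (suc l) × f (d + suc l) ≡ f a

  Loop? : ∀ f a l d → Dec (Loop f a l d)
  Loop? f a l d = Occ? f d a (suc l) ×-dec f (d + suc l) ≟ᴬ f a

  -- The word s x occurs at e.
  RevOcc : (ℕ → A) → ℕ → ℕ → ℕ → Set a
  RevOcc f a l e = ∀ i k → i + k ≡ l → f (e + i) ≡ f (a + k)

  RevOcc? : ∀ f a l e → Dec (RevOcc f a l e)
  RevOcc? f a l e = map′
    (λ all i k eq → all {i} (s≤s (m+n≤o⇒m≤o i (≤-reflexive eq))) {k} (s≤s (m+n≤o⇒n≤o i (≤-reflexive eq))) eq)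
    (λ rev {i} _ {k} _ → rev i k)
    (allUpTo? (λ i → allUpTo? (λ k → (i + k ≟ l) →-dec (f (e + i) ≟ᴬ f (a + k))) (suc l)) (suc l))

  -- As s is a palindrome, so is x s x; dropping its first letter leaves s x.
  Loop⇒RevOcc : ∀ {f a l d} → Fail f a l → Loop f a l d → RevOcc f a l (suc d)
  Loop⇒RevOcc {f} {a} {l} {d} (pal , _) (occ , fd≡) i zero eq =
    trans (cong f (by-≡ {suc d + i} {d + suc l} eq (solve (d ∷ i ∷ l ∷ [])))) (trans fd≡ (cong f (sym (+-identityʳ a))))
  Loop⇒RevOcc {f} {a} {l} {d} (pal , _) (occ , fd≡) i (suc k) eq = begin
    f (suc d + i)  ≡⟨ cong f (sym (+-suc d i)) ⟩
    f (d + suc i)  ≡⟨ occ (suc i) (by-≤ k (≤-reflexive eq) (solve (i ∷ k ∷ l ∷ []))) ⟩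
    f (a + suc i)  ≡⟨ pal (a + suc i) (a + suc k) (by-≤ i (z≤n {0}) (solve (a ∷ i ∷ []))) (by-≤ k (z≤n {0}) (solve (a ∷ k ∷ [])))
                        (by-≡ {suc (a + suc i + (a + suc k))} {suc a + (a + suc l)} eq (solve (a ∷ i ∷ k ∷ l ∷ []))) ⟩
    f (a + suc k)  ∎
    where open ≡-Reasoning

  -- Witness: from the last occurrence of x s x, without its first letter, to the end of the next x s.
  longer-fail : ∀ {f a l d} → AllNew f (a + suc l) → Fail f a l → d < a → Loop f a l d →
    ∃[ d ] ∃[ l′ ] l < l′ × d < a × d + suc l′ ≤ a + suc l × Loop f a l d × Fail f d l′
  longer-fail {f} {a} {l} all fail@(_ , x≢y) d₀<a loop₀
    with d , d<a , loop@(occ , _) , last ← greatest (Loop? f a l) a d₀<a loop₀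
    -- The next x s after `d`; at the latest it is the one at `a`.
    with e , e≤a , (d<e , occₑ) , first ← least (λ e → (d <? e) ×-dec Occ? f e a (suc l)) a (d<a , λ _ _ → refl)
    with t , refl ← <⇒gap d<e =
      d , t + suc l , (by-≤ t (z≤n {0}) (solve (l ∷ t ∷ []))) , d<a , end≤
    , loop , subst (Pal f (suc d)) (sym (+-suc d (t + suc l))) pal , λ same → differ (trans same (cong f shift))
    where
    shift : d + suc (t + suc l) ≡ suc (d + t) + suc l
    shift = ((d + suc (t + suc l) ≡ suc (d + t) + suc l) ∋ solve (d ∷ l ∷ t ∷ []))
    end≤ : d + suc (t + suc l) ≤ a + suc l
    end≤ = subst (_≤ a + suc l) (sym shift) (+-monoˡ-≤ (suc l) e≤a)
    pal : Pal f (suc d) (suc d + (t + suc l))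
    pal = return-suffix (suc d) (AllNew-≤ (subst (_≤ a + suc l) (+-suc d (t + suc l)) end≤) all) mirror
      λ c 0<c c<t occ′ → first (suc d + c) (+-monoʳ-< (suc d) c<t)
        ((by-≤ c (z≤n {0}) (solve (c ∷ d ∷ []))) , λ k k<m → trans (occ′ k k<m) (occₑ k k<m))
      where
      mirror : ∀ i k → k < suc l → suc (i + k) ≡ t + suc l → f (suc d + i) ≡ f (suc d + k)
      mirror i k k≤l eq with p , eq′ ← <⇒gap k≤l
        with refl ← (i ≡ t + p) ∋ (by-≡ {i} {t + p} (eq ⊕ sym eq′) (solve (i ∷ k ∷ l ∷ p ∷ t ∷ []))) =
        trans (cong f (sym (+-assoc (suc d) t p)))
          (trans (occₑ p (by-≤ k (≤-reflexive eq′) (solve (k ∷ l ∷ p ∷ []))))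
                 (sym (Loop⇒RevOcc fail loop k p (suc-injective eq′))))
    fd≡fa : f d ≡ f a
    fd≡fa = trans (cong f (sym (+-identityʳ d))) (trans (occ 0 z<s) (cong f (+-identityʳ a)))
    differ : f d ≢ f (suc (d + t) + suc l)
    -- If x followed this x s, then x s x would occur here, after its last occurrence `d`; and when
    -- this x s is the one at `a`, the letter after it is y.
    differ same with m≤n⇒m<n∨m≡n e≤a
    ... | inj₁ e<a  = last (suc (d + t)) d<e e<a (occₑ , trans (sym same) fd≡fa)
    ... | inj₂ refl = x≢y (trans (sym fd≡fa) same)

  -- If also `AllNew f (suc i)`, then `f i` and `h i` are two rich extensions of the prefix of
  -- length `i`.
  Branch : (ℕ → A) → ℕ → Set a
  Branch f i = ∃[ h ] (∀ k → k < i → h k ≡ f k) × h i ≢ f i × AllNew h (suc i)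

  -- Writing x in place of y makes x s x a palindromic suffix, which is new because x s x has no
  -- earlier occurrence.
  branch : ∀ {f a l} → AllNew f (a + suc l) → Fail f a l → (∀ d → d < a → ¬ Loop f a l d) → Branch f (a + suc l)
  branch {f} {a} {l} all (pal , x≢y) noLoop = h , h-old , (λ same → x≢y (trans (sym h-new) same)) , λ i i<sn →
      case m≤n⇒m<n∨m≡n (s≤s⁻¹ i<sn) of λ where
        (inj₁ i<n)  → New-cong (λ k k≤i → h-old k (<-≤-trans k≤i i<n)) (all i i<n)
        (inj₂ refl) → a , m≤m+n a (suc l) , Pal-∷ (trans (h-old a a<n) (sym h-new)) (Pal-cong h-old pal) , fresh
    where
    n = a + suc l
    a<n : a < n
    a<n = m<m+n a z<s
    h : ℕ → A
    h k with k ≟ n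
    ... | yes _ = f a
    ... | no  _ = f k
    h-old : ∀ k → k < n → h k ≡ f k
    h-old k k<n with k ≟ n
    ... | yes k≡n = ⊥-elim (<-irrefl k≡n k<n)
    ... | no  _   = refl
    h-new : h n ≡ f a
    h-new with n ≟ n
    ... | yes _  = refl
    ... | no n≢n = ⊥-elim (n≢n refl)
    fresh : Fresh h a (suc (a + suc l))
    fresh c l′ c<a eq occ
      with refl ← (l′ ≡ suc (suc l)) ∋ (by-≡ {l′} {suc (suc l)} eq (solve (a ∷ l ∷ l′ ∷ []))) =
      noLoop c c<a
        ( Occ-cong (λ k k<n → sym (h-old k k<n)) (<⇒≤ c<a) ≤-refl (λ k k<m → occ k (m<n⇒m<1+n k<m))
        , trans (sym (h-old (c + suc l) (+-monoˡ-< (suc l) c<a))) (trans (occ (suc l) ≤-refl) h-new))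

  -- Prolongation to a palindrome

  -- Each added letter closes a palindrome with the same centre as `[s, M)`, and an earlier copy of
  -- it would contain an earlier copy of `[s, M)`. That inner copy starts after `0`, so a copy of
  -- `[s, M)` at `0` is harmless; this lets a word that is already a palindrome be prolonged again.
  mirror-extension : ∀ {f : ℕ → A} {s M} → s ≤ M → Pal f s M → AllNew f M →
    (∀ c l → 0 < c → c < s → s + l ≡ M → ¬ Occ f c s l) →
    ∃[ g ] (∀ k → k < M → g k ≡ f k) × Pal g 0 (s + M) × AllNew g (s + M)
  mirror-extension {f} {s} {M} s≤M pal all none = g , g-old , pal′ , λ i i<sM →
      case i <? M of λ where
        (yes i<M) → New-cong (λ k k≤i → g-old k (<-≤-trans k≤i i<M)) (all i i<M)
        (no i≮M)  → new i (≮⇒≥ i≮M) i<sM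
    where
    g : ℕ → A
    g k with k <? M
    ... | yes _ = f k
    ... | no  _ = f (s + M ∸ suc k)
    g-old : ∀ k → k < M → g k ≡ f k
    g-old k k<M with k <? M
    ... | yes _   = refl
    ... | no  k≮M = ⊥-elim (k≮M k<M)
    pal′ : Pal g 0 (s + M)
    pal′ i k _ _ eq with i <? M | k <? M
    ... | yes i<M | yes k<M = pal i k (by-≤ 0 (≤-reflexive (sym eq) ⊞ k<M) (solve (M ∷ i ∷ k ∷ s ∷ [])))
                                      (by-≤ 0 (≤-reflexive (sym eq) ⊞ i<M) (solve (M ∷ i ∷ k ∷ s ∷ []))) eq
    ... | yes i<M | no k≮M  =
          cong f (sym (trans (cong (_∸ suc k) (sym (trans (cong suc (+-comm k i)) eq))) (m+n∸m≡n k i)))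
    ... | no i≮M  | yes k<M = cong f (trans (cong (_∸ suc i) (sym eq)) (m+n∸m≡n i k))
    ... | no i≮M  | no k≮M  with M≤i ← ≮⇒≥ i≮M | M≤k ← ≮⇒≥ k≮M =
          ⊥-elim (by-⊥ 0 (≤-reflexive eq ⊞ M≤i ⊞ M≤k ⊞ s≤M) (solve (M ∷ i ∷ k ∷ s ∷ [])))
    new : ∀ i → M ≤ i → i < s + M → New g i
    new i M≤i i<sM with t , eq ← <⇒gap i<sM =
        t , (by-≤ 1 (≤-reflexive eq ⊞ M≤i ⊞ M≤i ⊞ s≤M) (solve (M ∷ i ∷ s ∷ t ∷ [])))
      , (λ j k t≤j t≤k eq′ → pal′ j k z≤n z≤n (by-≡ {suc (j + k)} {s + M} (eq ⊕ eq′) (solve (M ∷ i ∷ j ∷ k ∷ s ∷ t ∷ []))))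
      , fresh
      where
      fresh : Fresh g t (suc i)
      fresh c l c<t eq′ occ
        with r , refl ← <⇒gap ((t < s) ∋ (by-≤ 0 (≤-reflexive eq ⊞ M≤i) (solve (M ∷ i ∷ s ∷ t ∷ []))))
        with l′ , refl ← m≤n⇒∃[o]m+o≡n s≤M =
        -- `suc r` is the distance from `t` to `s`, so the copy at `c` holds a copy of `[s, M)` at
        -- `c + suc r`.
        none (suc (c + r)) l′ z<s (s≤s (+-monoˡ-< r c<t)) refl λ k k<l′ → begin
          f (suc (c + r) + k)  ≡⟨ g-old _ (by-≤ 1 (c<t ⊞ k<l′) (solve (c ∷ k ∷ l′ ∷ r ∷ t ∷ []))) ⟨
          g (suc (c + r) + k)  ≡⟨ cong g ((suc (c + r) + k ≡ c + (suc r + k)) ∋ solve (c ∷ k ∷ r ∷ [])) ⟩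
          g (c + (suc r + k))  ≡⟨ occ (suc r + k) (by-≤ (r + 1) (k<l′ ⊞ ≤-reflexive (sym eq) ⊞ ≤-reflexive (sym eq′)) (solve (i ∷ k ∷ l ∷ l′ ∷ r ∷ t ∷ []))) ⟩
          g (t + (suc r + k))  ≡⟨ cong g ((t + (suc r + k) ≡ suc (t + r) + k) ∋ solve (k ∷ r ∷ t ∷ [])) ⟩
          g (suc (t + r) + k)  ≡⟨ g-old _ (+-monoʳ-< (suc (t + r)) k<l′) ⟩
          f (suc (t + r) + k)  ∎
        where open ≡-Reasoning

  -- Branching in a periodic prolongation

  module Periodic {f : ℕ → A} {n b : ℕ} (0<b : 0 < b) (all : AllNew f (n + b)) (period : ∀ i → i < n → f (b + i) ≡ f i) where

    Fail-shift : ∀ {a l} → a + suc l < n → Fail f a l → Fail f (b + a) l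
    Fail-shift {a} {l} i<n (pal , x≢y) =
        (λ i k i> k> eq → shifted i k i> k> eq)
      , λ same → x≢y (trans (sym (period a (≤-<-trans (m≤m+n a (suc l)) i<n)))
                       (trans same (trans (cong f (+-assoc b a (suc l))) (period (a + suc l) i<n))))
      where
      shifted : Pal f (suc (b + a)) (b + a + suc l)
      shifted i k i> k> eq
        with i′ , refl ← m≤n⇒∃[o]m+o≡n i>
           | k′ , refl ← m≤n⇒∃[o]m+o≡n k> = begin
          f (suc (b + a) + i′)  ≡⟨ cong f ((suc (b + a) + i′ ≡ b + (suc a + i′)) ∋ solve (a ∷ b ∷ i′ ∷ [])) ⟩
          f (b + (suc a + i′))  ≡⟨ period (suc a + i′) (by-≤ (k′ + 1) (≤-reflexive eq ⊞ i<n) (solve (a ∷ b ∷ i′ ∷ k′ ∷ l ∷ n ∷ []))) ⟩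
          f (suc a + i′)        ≡⟨ pal (suc a + i′) (suc a + k′) (m≤m+n (suc a) i′) (m≤m+n (suc a) k′)
                                    (by-≡ {suc (suc a + i′ + (suc a + k′))} {suc a + (a + suc l)} eq (solve (a ∷ b ∷ i′ ∷ k′ ∷ l ∷ []))) ⟩
          f (suc a + k′)        ≡⟨ period (suc a + k′) (by-≤ (i′ + 1) (≤-reflexive eq ⊞ i<n) (solve (a ∷ b ∷ i′ ∷ k′ ∷ l ∷ n ∷ []))) ⟨
          f (b + (suc a + k′))  ≡⟨ cong f ((b + (suc a + k′) ≡ suc (b + a) + k′) ∋ solve (a ∷ b ∷ k′ ∷ [])) ⟩
          f (suc (b + a) + k′)  ∎
        where open ≡-Reasoning

    -- Shifts by `b` cannot jump over a window of length `b`; `fuel` bounds the distance still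
    -- missing to `n`.
    Fail-move : ∀ fuel {a l} → n ≤ a + suc l + fuel → a + suc l < n + b → Fail f a l →
                ∃[ a′ ] n ≤ a′ + suc l × a′ + suc l < n + b × Fail f a′ l
    Fail-move fuel {a} {l} n≤ i< fail with n ≤? a + suc l
    Fail-move fuel {a} {l} n≤ i< fail | yes n≤i = a , n≤i , i< , fail
    Fail-move zero {a} {l} n≤ i< fail | no n≰i = ⊥-elim (n≰i (subst (n ≤_) (+-identityʳ (a + suc l)) n≤))
    Fail-move (suc fuel) {a} {l} n≤ i< fail | no n≰i with i<n ← ≰⇒> n≰i =
      Fail-move fuel {b + a} {l} (by-≤ 0 (n≤ ⊞ 0<b) (solve (a ∷ b ∷ fuel ∷ l ∷ n ∷ [])))
        (by-≤ 0 i<n (solve (a ∷ b ∷ l ∷ n ∷ []))) (Fail-shift i<n fail)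

    -- Each blocked attempt yields a longer palindrome, whose length stays below `n + b`; `fuel`
    -- bounds the room left.
    find-branch : ∀ fuel {a l} → n + b ≤ l + fuel → a + suc l < n + b → Fail f a l →
                  ∃[ i ] n ≤ i × i < n + b × Branch f i
    find-branch zero {a} {l} long i< _ = ⊥-elim (by-⊥ (a + 1) (long ⊞ i<) (solve (a ∷ b ∷ l ∷ n ∷ [])))
    find-branch (suc fuel) {a₀} {l} long i< fail₀
      with a , n≤i , i<n+b , fail ← Fail-move n (m≤n+m n (a₀ + suc l)) i< fail₀
      with anyUpTo? (Loop? f a l) a
    ... | no noLoop = a + suc l , n≤i , i<n+b
                    , branch (AllNew-≤ (<⇒≤ i<n+b) all) fail λ d d<a loop → noLoop (d , d<a , loop)
    ... | yes (_ , d<a , loop)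
      with d , l′ , l<l′ , _ , end≤ , _ , fail′ ← longer-fail (AllNew-≤ (<⇒≤ i<n+b) all) fail d<a loop =
      find-branch fuel {d} {l′} (by-≤ 0 (long ⊞ l<l′) (solve (b ∷ fuel ∷ l ∷ l′ ∷ n ∷ []))) (≤-<-trans end≤ i<n+b) fail′

  -- Branching inside a palindrome with only short proper palindromic suffixes

  module Aperiodic {f : ℕ → A} {j n b : ℕ} (all : AllNew f (j + n)) (pal : Pal f 0 (j + n))
                   (j≤n : j ≤ n) (palⱼ : Pal f j n) (freshⱼ : Fresh f j n)
                   (n<b : n < b) (noPal : ∀ c → 0 < c → c < b → ¬ Pal f c (j + n)) where

    -- Reflection in the centre of p exchanges the two unequal letters; position `d` goes to
    -- `j + n - 1 - d`, which is at least `n` because `d < j`.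
    Fail-mirror : ∀ {d l} → suc d ≤ j → d + suc l < j + n → Fail f d l →
                  ∃[ d′ ] n ≤ d′ + suc l × d′ + suc l < j + n × Fail f d′ l
    Fail-mirror {d} {l} d<j i<N (palₛ , x≢y) with d′ , eq ← <⇒gap i<N =
        d′ , (by-≤ 0 (≤-reflexive (sym eq) ⊞ d<j) (solve (d ∷ d′ ∷ j ∷ l ∷ n ∷ [])))
      , (by-≤ d (≤-reflexive eq) (solve (d ∷ d′ ∷ j ∷ l ∷ n ∷ [])))
      , mirrored
      , λ same → x≢y (trans (pal d (d′ + suc l) z≤n z≤n (by-≡ {suc (d + (d′ + suc l))} {j + n} eq (solve (d ∷ d′ ∷ j ∷ l ∷ n ∷ []))))
                       (trans (sym same) (pal d′ (d + suc l) z≤n z≤n (by-≡ {suc (d′ + (d + suc l))} {j + n} eq (solve (d ∷ d′ ∷ j ∷ l ∷ n ∷ []))))))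
      where
      mirrored : Pal f (suc d′) (d′ + suc l)
      mirrored i k i> k> ik
        with i′ , ii ← <⇒gap ((i < j + n) ∋ (by-≤ (d + 1) (≤-reflexive ik ⊞ k> ⊞ ≤-reflexive eq) (solve (d ∷ d′ ∷ i ∷ j ∷ k ∷ l ∷ n ∷ []))))
           | k′ , kk ← <⇒gap ((k < j + n) ∋ (by-≤ (d + 1) (≤-reflexive ik ⊞ i> ⊞ ≤-reflexive eq) (solve (d ∷ d′ ∷ i ∷ j ∷ k ∷ l ∷ n ∷ [])))) =
        trans (pal i i′ z≤n z≤n ii) (trans (palₛ i′ k′
          (by-≤ 0 (≤-reflexive (sym ii) ⊞ ≤-reflexive eq ⊞ ≤-reflexive ik ⊞ k>) (solve (d ∷ d′ ∷ i ∷ i′ ∷ j ∷ k ∷ l ∷ n ∷ [])))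
          (by-≤ 0 (≤-reflexive (sym kk) ⊞ ≤-reflexive eq ⊞ ≤-reflexive ik ⊞ i>) (solve (d ∷ d′ ∷ i ∷ j ∷ k ∷ k′ ∷ l ∷ n ∷ [])))
          (by-≡ {suc (i′ + k′)} {suc d + (d + suc l)} (ii ⊕ kk ⊕ sym eq ⊕ sym eq ⊕ sym ik) (solve (d ∷ d′ ∷ i ∷ i′ ∷ j ∷ k ∷ k′ ∷ l ∷ n ∷ []))))
          (sym (pal k k′ z≤n z≤n kk)))

    -- `r` counts the letters from `i` to the end of p. The centre of `[e, i)` lies to the right of
    -- that of p, so growth on both sides either stops at two unequal letters or reaches the right
    -- end first.
    Pal-extend : ∀ r {e i} → i + r ≡ j + n → j + n < e + i → n ≤ i → e ≤ i → Pal f e i →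
      (∃[ e′ ] ∃[ l ] n ≤ e′ + suc l × e′ + suc l < j + n × i ≤ e + l × Fail f e′ l) ⊎
      (∃[ z ] z + r ≡ e × Pal f z (j + n))
    Pal-extend zero {e} {i} eq _ _ _ palₑ =
      inj₂ (e , +-identityʳ e , subst (Pal f e) (trans (sym (+-identityʳ i)) eq) palₑ)
    Pal-extend (suc r) {zero} {i} eq N< _ _ _ = ⊥-elim (by-⊥ (r + 1) (≤-reflexive eq ⊞ N<) (solve (i ∷ j ∷ n ∷ r ∷ [])))
    Pal-extend (suc r) {suc e} {i} eq N< n≤i e<i palₑ with f e ≟ᴬ f i
    ... | yes same with Pal-extend r {e} {suc i} (trans (sym (+-suc i r)) eq) (subst (j + n <_) (sym (+-suc e i)) N<)
                          (m≤n⇒m≤1+n n≤i) (m≤n⇒m≤1+n (<⇒≤ e<i)) (Pal-∷ same palₑ)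
    ...   | inj₁ (e′ , l , n≤ , <N , i≤ , fail) =
            inj₁ (e′ , l , n≤ , <N , (by-≤ 2 i≤ (solve (e ∷ i ∷ l ∷ []))) , fail)
    ...   | inj₂ (z , z≡ , palz) = inj₂ (z , trans (+-suc z r) (cong suc z≡) , palz)
    Pal-extend (suc r) {suc e} {i} eq N< n≤i e<i palₑ | no differ with l , refl ← <⇒gap e<i =
      inj₁ (e , l , (by-≤ 0 n≤i (solve (e ∷ l ∷ n ∷ []))) , (by-≤ r (≤-reflexive eq) (solve (e ∷ j ∷ l ∷ n ∷ r ∷ []))) , ≤-refl
           , subst (Pal f (suc e)) (sym (+-suc e l)) palₑ , λ same → differ (trans same (cong f (+-suc e l))))

    -- Such a palindrome would contain `[j, n)` and reflect it to a copy starting at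
    -- `e + i - n < j`, against `freshⱼ`.
    left-of-centre : ∀ {e i} → n ≤ i → e + i < j + n → ¬ Pal f e i
    left-of-centre {e} {i} n≤i e+i< palₑ
      with i′ , refl ← m≤n⇒∃[o]m+o≡n n≤i
         | l , j+l≡n ← m≤n⇒∃[o]m+o≡n j≤n =
      freshⱼ (e + i′) l (by-≤ 0 e+i< (solve (e ∷ i′ ∷ j ∷ n ∷ []))) j+l≡n λ k k<l → occ k (<⇒gap k<l)
      where
      occ : ∀ k → ∃[ p ] suc (k + p) ≡ l → f (e + i′ + k) ≡ f (j + k)
      occ k (p , eq) = trans
        (palₑ (e + i′ + k) (j + p) (by-≤ (i′ + k) (z≤n {0}) (solve (e ∷ i′ ∷ k ∷ []))) (by-≤ (i′ + p + 1) e+i< (solve (e ∷ i′ ∷ j ∷ n ∷ p ∷ [])))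
          (by-≡ {suc (e + i′ + k + (j + p))} {e + (n + i′)} (eq ⊕ j+l≡n) (solve (e ∷ i′ ∷ j ∷ k ∷ l ∷ n ∷ p ∷ []))))
        (palⱼ (j + p) (j + k) (m≤m+n j p) (m≤m+n j k)
          (by-≡ {suc (j + p + (j + k))} {j + n} (eq ⊕ j+l≡n) (solve (j ∷ k ∷ l ∷ n ∷ p ∷ []))))

    -- The interval starts with s x and ends with its reversal x s, and no s x starts strictly
    -- between `e` and `a`, so it is a complete return.
    last-return : ∀ {a l e} → AllNew f (a + suc l) → Greatest (RevOcc f a l) a e → Pal f e (a + suc l)
    last-return {a} {l} {e} all′ (e<a , rev , last)
      with q , refl ← m≤n⇒∃[o]m+o≡n (<⇒≤ e<a) = subst (Pal f e) (sym (+-assoc e q (suc l)))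
        (return-prefix e (subst (AllNew f) (+-assoc e q (suc l)) all′) mirror
          λ c 0<c c+l< occ → last (e + c) (by-≤ 0 0<c (solve (c ∷ e ∷ []))) (by-≤ 0 c+l< (solve (c ∷ e ∷ l ∷ q ∷ [])))
            λ i k eq → trans (sym (occ i (by-≤ k (≤-reflexive eq) (solve (i ∷ k ∷ l ∷ []))))) (rev i k eq))
      where
      mirror : ∀ i k → k < suc l → suc (i + k) ≡ q + suc l → f (e + i) ≡ f (e + k)
      mirror i k k≤l eq with p , eq′ ← <⇒gap k≤l
        with refl ← (i ≡ q + p) ∋ (by-≡ {i} {q + p} (eq ⊕ sym eq′) (solve (i ∷ k ∷ l ∷ p ∷ q ∷ []))) =
        trans (cong f (sym (+-assoc e q p))) (sym (rev k p (suc-injective eq′)))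

    RevOcc⇒Pal : ∀ {a l e} → Fail f a l → RevOcc f a l e → Pal f e (e + l)
    RevOcc⇒Pal {a} {l} {e} (palₛ , _) rev = Pal-shift e mirror
      where
      mirror : ∀ i k → suc (i + k) ≡ l → f (e + i) ≡ f (e + k)
      mirror i k eq = begin
        f (e + i)      ≡⟨ rev i (suc k) (trans (+-suc i k) eq) ⟩
        f (a + suc k)  ≡⟨ palₛ (a + suc k) (a + suc i) (by-≤ k (z≤n {0}) (solve (a ∷ k ∷ []))) (by-≤ i (z≤n {0}) (solve (a ∷ i ∷ [])))
                            (by-≡ {suc (a + suc k + (a + suc i))} {suc a + (a + suc l)} eq (solve (a ∷ i ∷ k ∷ l ∷ []))) ⟩
        f (a + suc i)  ≡⟨ rev k (suc i) (trans (+-suc k i) (trans (cong suc (+-comm k i)) eq)) ⟨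
        f (e + k)      ∎
        where open ≡-Reasoning

    -- The palindromic suffix `[z, j + n)` reflects the y at `a + suc l` to the position just before
    -- `e`. There s lies between y and x: the same failure with the letters exchanged.
    earlier-Fail : ∀ {a l e z r} → Fail f a l → RevOcc f a l e → z + suc r ≡ e → e < a → Pal f z (j + n) →
                   a + suc l + suc r ≡ j + n → ∃[ a′ ] suc a′ ≡ e × Fail f a′ l
    earlier-Fail {a} {l} {zero} {z} {r} _ _ eq _ _ _ = ⊥-elim (by-⊥ (r + z) (≤-reflexive eq) (solve (r ∷ z ∷ [])))
    earlier-Fail {a} {l} {suc e} {z} {r} fail@(_ , x≢y) rev eq e<a palz eq′ =
      e , refl , subst (Pal f (suc e)) (sym (+-suc e l)) (RevOcc⇒Pal fail rev) , λ same → x≢y (begin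
        f a            ≡⟨ cong f (sym (+-identityʳ a)) ⟩
        f (a + 0)      ≡⟨ rev l 0 (+-identityʳ l) ⟨
        f (suc e + l)  ≡⟨ cong f (sym (+-suc e l)) ⟩
        f (e + suc l)  ≡⟨ same ⟨
        f e            ≡⟨ palz e (a + suc l) (by-≤ r (≤-reflexive eq) (solve (e ∷ r ∷ z ∷ [])))
                            (by-≤ (l + r + 3) (≤-reflexive eq ⊞ e<a) (solve (a ∷ e ∷ l ∷ r ∷ z ∷ [])))
                            (by-≡ {suc (e + (a + suc l))} {z + (j + n)} (sym eq ⊕ eq′) (solve (a ∷ e ∷ j ∷ l ∷ n ∷ r ∷ z ∷ []))) ⟩
        f (a + suc l)  ∎)
      where open ≡-Reasoning

    InRange : ℕ → ℕ → Set
    InRange a l = n ≤ a + suc l × a + suc l < j + n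

    progress : ∀ {a l} → InRange a l → Fail f a l →
      Branch f (a + suc l) ⊎
      (∃[ a′ ] ∃[ l′ ] l < l′ × InRange a′ l′ × Fail f a′ l′) ⊎
      (∃[ a′ ] a′ < a × InRange a′ l × Fail f a′ l)
    progress {a} {l} (n≤i , i<N) fail
      with anyUpTo? (Loop? f a l) a
    ... | no noLoop = inj₁ (branch (AllNew-≤ (<⇒≤ i<N) all) fail λ d d<a loop → noLoop (d , d<a , loop))
    ... | yes (_ , d₀<a , loop₀)
      with d , l′ , l<l′ , d<a , end≤ , loop , fail′ ← longer-fail (AllNew-≤ (<⇒≤ i<N) all) fail d₀<a loop₀
      with n ≤? d + suc l′
    ...   | yes n≤i′ = inj₂ (inj₁ (d , l′ , l<l′ , (n≤i′ , ≤-<-trans end≤ i<N) , fail′))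
    ...   | no n≰i′ with i′<n ← ≰⇒> n≰i′
      -- F is longer than s but ends before the x s at `a` does, so the s x at `suc d` starts before
      -- `a`.
      with sd<a ← (suc d < a) ∋ (by-≤ 0 (i′<n ⊞ n≤i ⊞ l<l′) (solve (a ∷ d ∷ l ∷ l′ ∷ n ∷ [])))
      with e , great@(e<a , rev , last) ← greatest (RevOcc? f a l) a sd<a (Loop⇒RevOcc fail loop)
      with d<e ← ≮⇒≥ (λ e<d → last (suc d) e<d sd<a (Loop⇒RevOcc fail loop))
      with palₑ ← last-return (AllNew-≤ (<⇒≤ i<N) all) great
      with <-cmp (e + (a + suc l)) (j + n)
    ...     | tri< left _ _ = ⊥-elim (left-of-centre n≤i left palₑ)
    -- Here `d < e = j + n - (a + suc l) ≤ j`, so the mirror image of F ends late enough.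
    ...     | tri≈ _ centre _
      with d′ , n≤ , <N , fail″ ← Fail-mirror {d} {l′}
             (by-≤ 0 (d<e ⊞ ≤-reflexive centre ⊞ n≤i) (solve (a ∷ d ∷ e ∷ j ∷ l ∷ n ∷ []))) (≤-<-trans end≤ i<N) fail′ =
      inj₂ (inj₁ (d′ , l′ , l<l′ , (n≤ , <N) , fail″))
    ...     | tri> _ _ right
      with r , eq ← <⇒gap i<N
      with Pal-extend (suc r) {e} {a + suc l} (trans (+-suc (a + suc l) r) eq) right n≤i (by-≤ (l + 2) e<a (solve (a ∷ e ∷ l ∷ []))) palₑ
    ...       | inj₁ (e′ , l″ , n≤ , <N , i≤ , fail″) =
      inj₂ (inj₁ (e′ , l″ , (by-≤ 1 (i≤ ⊞ e<a) (solve (a ∷ e ∷ l ∷ l″ ∷ []))) , (n≤ , <N) , fail″))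
    ...       | inj₂ (z , z≡ , palz)
      -- `z` is positive because the centre lies to the right; minimality of `b` then gives
      -- `n < b ≤ z`, which keeps the earlier failure in range.
      with b≤z ← ≮⇒≥ (λ z<b → noPal z (by-≤ 0 (right ⊞ ≤-reflexive eq ⊞ ≤-reflexive (sym z≡)) (solve (a ∷ e ∷ j ∷ l ∷ n ∷ r ∷ z ∷ []))) z<b palz)
      with a′ , refl , fail″ ← earlier-Fail fail rev z≡ e<a palz (trans (+-suc (a + suc l) r) eq) =
      inj₂ (inj₂ (a′ , <-trans (n<1+n a′) e<a
        , ( (by-≤ (l + r + 2) (n<b ⊞ b≤z ⊞ ≤-reflexive z≡) (solve (a′ ∷ b ∷ l ∷ n ∷ r ∷ z ∷ [])))
          , (by-≤ 2 (e<a ⊞ i<N) (solve (a ∷ a′ ∷ j ∷ l ∷ n ∷ []))))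
        , fail″))

    mutual
      -- Lexicographic recursion: `fuel` bounds the growth of the palindrome, `fuel′` the moves to
      -- the left at a fixed length. A longer palindrome resets `fuel′`.
      find-branch : ∀ fuel fuel′ {a l} → j + n ≤ l + fuel → a < fuel′ → InRange a l → Fail f a l →
                    ∃[ i ] n ≤ i × i < j + n × Branch f i
      find-branch fuel (suc fuel′) {a} {l} long (s≤s early) range@(n≤i , i<N) fail with progress range fail
      ... | inj₁ br = a + suc l , n≤i , i<N , br
      ... | inj₂ (inj₁ (_ , _ , l<l′ , range′ , fail′)) = find-longer fuel long l<l′ range′ fail′
      ... | inj₂ (inj₂ (_ , a′<a , range′ , fail′)) = find-branch fuel fuel′ long (<-≤-trans a′<a early) range′ fail′

      find-longer : ∀ fuel {l a′ l′} → j + n ≤ l + fuel → l < l′ → InRange a′ l′ → Fail f a′ l′ →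
                    ∃[ i ] n ≤ i × i < j + n × Branch f i
      find-longer zero {l} {a′} {l′} long l<l′ (_ , i<N) _ =
        ⊥-elim (by-⊥ (a′ + 2) (long ⊞ l<l′ ⊞ i<N) (solve (a′ ∷ j ∷ l ∷ l′ ∷ n ∷ [])))
      find-longer (suc fuel) {l} {a′} {l′} long l<l′ range fail =
        find-branch fuel (suc a′) {a′} {l′} (by-≤ 0 (long ⊞ l<l′) (solve (fuel ∷ j ∷ l ∷ l′ ∷ n ∷ []))) ≤-refl range fail

  -- Starting points and the branching within length 2n

  constant : ∀ {f : ℕ → A} s {e} → (∀ k → s ≤ k → suc k < e → f k ≡ f (suc k)) → ∀ k → s + k < e → f (s + k) ≡ f s
  constant {f} s steps zero    _     = cong f (+-identityʳ s)
  constant {f} s {e} steps (suc k) s+k<e with s+k<e′ ← subst (_< e) (+-suc s k) s+k<e =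
    trans (cong f (+-suc s k)) (trans (sym (steps (s + k) (m≤m+n s k) s+k<e′)) (constant s steps k (<-trans (n<1+n _) s+k<e′)))

  constant⇒Pal : ∀ {f : ℕ → A} {s e} → (∀ k → s + k < e → f (s + k) ≡ f s) → Pal f s e
  constant⇒Pal {f} {s} {e} const i k s≤i s≤k eq
    with i′ , refl ← m≤n⇒∃[o]m+o≡n s≤i
       | k′ , refl ← m≤n⇒∃[o]m+o≡n s≤k =
    trans (const i′ (by-≤ k′ (≤-reflexive eq) (solve (e ∷ i′ ∷ k′ ∷ s ∷ []))))
          (sym (const k′ (by-≤ i′ (≤-reflexive eq) (solve (e ∷ i′ ∷ k′ ∷ s ∷ [])))))

  -- The starting point of both searches: s is empty, and x and y are adjacent.
  Fail-empty : ∀ {f : ℕ → A} a → f a ≢ f (suc a) → Fail f a 0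
  Fail-empty {f} a differ =
      subst (Pal f (suc a)) (+-comm 1 a) (Pal-empty f (suc a))
    , λ same → differ (trans same (cong f (+-comm a 1)))

  -- `i` is the length of wu, so `i ≤ n + n` is the bound on the length of u.
  Branching : (ℕ → A) → ℕ → Set a
  Branching f n = ∃[ g ] ∃[ i ] (∀ k → k < n → g k ≡ f k) × n ≤ i × i ≤ n + n × AllNew g (suc i) × Branch g i

  -- From the last copy of `[b, N)` that starts before `b` to the end of the word is a complete
  -- return, hence a palindromic suffix of the kind that `noPal` excludes.
  no-inner-occurrence : ∀ {f : ℕ → A} {N b} → AllNew f N → Pal f b N → (∀ c → 0 < c → c < b → ¬ Pal f c N) →
                        ∀ c l → 0 < c → c < b → b + l ≡ N → ¬ Occ f c b l
  no-inner-occurrence {f} {N} {b} all pal noPal c₀ l 0<c₀ c₀<b refl occ₀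
    with c , c<b , occ , last ← greatest (λ c → Occ? f c b l) b c₀<b occ₀
    with c₀≤c ← ≮⇒≥ (λ c<c₀ → last c₀ c<c₀ c₀<b occ₀)
    with q , refl ← m≤n⇒∃[o]m+o≡n (<⇒≤ c<b) =
    noPal c (≤-trans 0<c₀ c₀≤c) c<b (subst (Pal f c) (sym (+-assoc c q l))
      (return-prefix c (subst (AllNew f) (+-assoc c q l) all) mirror
        λ c′ 0<c′ c′+l< occ′ → last (c + c′) (by-≤ 0 0<c′ (solve (c ∷ c′ ∷ []))) (by-≤ 0 c′+l< (solve (c ∷ c′ ∷ l ∷ q ∷ [])))
          λ k k<l → trans (sym (occ′ k k<l)) (occ k k<l)))
    where
    mirror : ∀ i k → k < l → suc (i + k) ≡ q + l → f (c + i) ≡ f (c + k)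
    mirror i k k<l eq with p , refl ← <⇒gap k<l
      with refl ← (i ≡ q + p) ∋ (by-≡ {i} {q + p} eq (solve (i ∷ k ∷ p ∷ q ∷ []))) =
      trans (cong f (sym (+-assoc c q p)))
        (trans (pal (c + q + p) (c + q + k) (m≤m+n (c + q) p) (m≤m+n (c + q) k)
                 ((suc (c + q + p + (c + q + k)) ≡ c + q + (c + q + suc (k + p))) ∋ solve (c ∷ k ∷ p ∷ q ∷ [])))
               (sym (occ k k<l)))

  -- A power of one letter can be followed by that letter again, or by `z`, which is a new
  -- palindrome by itself.
  unary-branching : ∀ {f : ℕ → A} {n z} → z ≢ f 0 → (∀ k → k < n → f k ≡ f 0) → Branching f n
  unary-branching {f} {n} {z} z≢f0 const =
      (λ _ → f 0) , n , (λ k k<n → sym (const k k<n)) , ≤-refl , m≤m+n n n , (λ i _ → new i)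
    , h , h-old , (λ same → z≢f0 (trans (sym h-new) same)) , λ i i<sn →
      case m≤n⇒m<n∨m≡n (s≤s⁻¹ i<sn) of λ where
        (inj₁ i<n)  → New-cong (λ k k≤i → h-old k (<-≤-trans k≤i i<n)) (new i)
        (inj₂ refl) → n , ≤-refl , single , fresh
    where
    new : ∀ i → New (λ _ → f 0) i
    new i = 0 , z≤n , (λ _ _ _ _ _ → refl) , λ _ _ ()
    h : ℕ → A
    h k with k <? n
    ... | yes _ = f 0
    ... | no  _ = z
    h-old : ∀ k → k < n → h k ≡ f 0
    h-old k k<n with k <? n
    ... | yes _  = refl
    ... | no k≮n = ⊥-elim (k≮n k<n)
    h-new : h n ≡ z
    h-new with n <? n
    ... | yes n<n = ⊥-elim (<-irrefl refl n<n)
    ... | no _    = refl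
    single : Pal h n (suc n)
    single i k n≤i n≤k eq =
      cong h (≤-antisym (by-≤ 0 (≤-reflexive eq ⊞ n≤k ⊞ n≤k) (solve (i ∷ k ∷ n ∷ [])))
                        (by-≤ 0 (≤-reflexive eq ⊞ n≤i ⊞ n≤i) (solve (i ∷ k ∷ n ∷ []))))
    fresh : Fresh h n (suc n)
    fresh c l c<n eq occ with refl ← (l ≡ 1) ∋ (by-≡ {l} {1} eq (solve (l ∷ n ∷ []))) =
      z≢f0 (begin
        z          ≡⟨ h-new ⟨
        h n        ≡⟨ cong h (sym (+-identityʳ n)) ⟩
        h (n + 0)  ≡⟨ occ 0 z<s ⟨
        h (c + 0)  ≡⟨ cong h (+-identityʳ c) ⟩
        h c        ≡⟨ h-old c c<n ⟩
        f 0        ∎)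
      where open ≡-Reasoning

  short-period : ∀ {f g : ℕ → A} {n j b z} → z ≢ f 0 → (∀ k → k < n → g k ≡ f k) →
    AllNew g (j + n) → Pal g 0 (j + n) → 0 < b → b ≤ n → Pal g b (j + n) →
    (∀ c → 0 < c → c < b → ¬ Pal g c (j + n)) → Branching f n
  short-period {f} {g} {n} {j} {b} z≢f0 g≡f allg palg 0<b b≤n palb noPal
    -- A second prolongation, around the palindromic suffix of p that starts at `b`.
    with g′ , g′≡g , pal′ , all′ ← mirror-extension (m≤n⇒m≤o+n j b≤n) palb allg (no-inner-occurrence allg palb noPal)
    with anyUpTo? (λ k → (suc k <? n) ×-dec ¬? (f k ≟ᴬ f (suc k))) n
  ... | no none = unary-branching z≢f0
        (constant 0 λ k _ sk<n → decidable-stable (f k ≟ᴬ f (suc k)) λ differ → none (k , <-trans (n<1+n k) sk<n , sk<n , differ))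
  ... | yes (k , k<n , sk<n , differ) = conclude
          (Periodic.find-branch 0<b all″ period (n + b) {k} {0} ≤-refl (by-≤ b sk<n (solve (b ∷ k ∷ n ∷ [])))
            (Fail-empty k λ same → differ (trans (sym (g′≡f k k<n)) (trans same (g′≡f (suc k) sk<n)))))
    where
    g′≡f : ∀ k → k < n → g′ k ≡ f k
    g′≡f k k<n = trans (g′≡g k (m≤n⇒m≤o+n j k<n)) (g≡f k k<n)
    all″ : AllNew g′ (n + b)
    all″ = AllNew-≤ {m = n + b} {b + (j + n)} (by-≤ j (z≤n {0}) (solve (b ∷ j ∷ n ∷ []))) all′
    -- Both p and its prolongation are palindromes, and the composition of the two reflections is
    -- the shift by `b`.
    period : ∀ i → i < n → g′ (b + i) ≡ g′ i
    period i i<n with k , eq ← <⇒gap (m≤n⇒m≤o+n j i<n) = begin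
      g′ (b + i)  ≡⟨ pal′ (b + i) k z≤n z≤n (by-≡ {suc (b + i + k)} {b + (j + n)} eq (solve (b ∷ i ∷ j ∷ k ∷ n ∷ []))) ⟩
      g′ k        ≡⟨ g′≡g k (subst (k <_) eq (s≤s (m≤n+m k i))) ⟩
      g k         ≡⟨ palg i k z≤n z≤n eq ⟨
      g i         ≡⟨ g′≡g i (m≤n⇒m≤o+n j i<n) ⟨
      g′ i        ∎
      where open ≡-Reasoning
    conclude : ∃[ i ] n ≤ i × i < n + b × Branch g′ i → Branching f n
    conclude (i , n≤i , i<n+b , br) =
      g′ , i , g′≡f , n≤i , ≤-trans (<⇒≤ i<n+b) (+-monoʳ-≤ n b≤n) , AllNew-≤ i<n+b all″ , br

  long-period : ∀ {f g : ℕ → A} {n j b} → (∀ k → k < n → g k ≡ f k) → j < n → Pal f j n → Fresh f j n →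
    AllNew g (j + n) → Pal g 0 (j + n) → n < b → b ≤ j + n →
    (∀ c → 0 < c → c < b → ¬ Pal g c (j + n)) → Branching f n
  long-period {f} {g} {suc m} {j} {b} g≡f j<n palⱼ freshⱼ allg palg n<b b≤N noPal
    -- With `n = suc m`, the condition `m ≤ k` makes the initial failure end at `suc k ≥ n`.
    with anyUpTo? (λ k → (m ≤? k) ×-dec (suc k <? j + suc m) ×-dec ¬? (g k ≟ᴬ g (suc k))) (j + suc m)
  -- Equal letters from `m` on would form a palindromic suffix; `m` is positive because
  -- `suc m < b ≤ j + suc m` and `j < suc m`.
  ... | no none = ⊥-elim (noPal m
          (by-≤ 0 (n<b ⊞ b≤N ⊞ j<n) (solve (b ∷ j ∷ m ∷ []))) (<-trans (n<1+n m) n<b)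
          (constant⇒Pal (constant m λ k m≤k sk<N → decidable-stable (g k ≟ᴬ g (suc k)) λ differ →
            none (k , <-trans (n<1+n k) sk<N , m≤k , sk<N , differ))))
  ... | yes (k , k<N , m≤k , sk<N , differ) =
    conclude (Aperiodic.find-branch allg palg (<⇒≤ j<n) (Pal-cong g≡f palⱼ)
      (λ c l c<j eq occ → freshⱼ c l c<j eq (Occ-cong (λ k k<n → sym (g≡f k k<n)) (<⇒≤ c<j) (≤-reflexive eq) occ))
      n<b noPal (j + suc m) (suc k) {k} {0} ≤-refl ≤-refl
      ((by-≤ 0 m≤k (solve (k ∷ m ∷ []))) , (by-≤ 0 sk<N (solve (j ∷ k ∷ m ∷ [])))) (Fail-empty k differ))
    where
    conclude : ∃[ i ] suc m ≤ i × i < j + suc m × Branch g i → Branching f (suc m)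
    conclude (i , n≤i , i<N , br) =
      g , i , g≡f , n≤i , ≤-trans (<⇒≤ i<N) (+-monoˡ-≤ (suc m) (<⇒≤ j<n)) , AllNew-≤ i<N allg , br

  branching : ∀ {f : ℕ → A} {n z} → z ≢ f 0 → 0 < n → AllNew f n → Branching f n
  branching {f} {suc m} z≢f0 _ all
    with j , j≤m , palⱼ , freshⱼ ← all m ≤-refl
    with g , g≡f , palg , allg ← mirror-extension (m≤n⇒m≤1+n j≤m) palⱼ all (λ c l _ → freshⱼ c l)
    -- The least positive start of a palindromic suffix of p; the empty suffix guarantees that there
    -- is one.
    with b , b≤N , (0<b , palb) , min ← least (λ b → (0 <? b) ×-dec Pal? g b (j + suc m)) (j + suc m)
           (m≤n⇒m≤o+n j z<s , Pal-empty g (j + suc m))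
    with b ≤? suc m
  ... | yes b≤n = short-period z≢f0 g≡f allg palg 0<b b≤n palb λ c 0<c c<b pal → min c c<b (0<c , pal)
  ... | no b≰n = long-period g≡f (s≤s j≤m) palⱼ freshⱼ allg palg (≰⇒> b≰n) b≤N λ c 0<c c<b pal → min c c<b (0<c , pal)

  -- From positions back to words

  -- `d` is the value past the end; only positions below the length matter.
  nth : A → List A → ℕ → A
  nth d []      _       = d
  nth d (x ∷ w) zero    = x
  nth d (x ∷ w) (suc i) = nth d w i

  fw-nth : ∀ d w → fw (nth d w) 0 (length w) ≡ w
  fw-nth d []      = refl
  fw-nth d (x ∷ w) = cong (x ∷_)
    (trans (fw-cong (nth d (x ∷ w)) (nth d w) 1 0 (length w) λ _ _ → refl) (fw-nth d w))

  Rich⇒AllNew-nth : ∀ d {w : List A} → Rich w → AllNew (nth d w) (length w)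
  Rich⇒AllNew-nth d {w} rich = Rich⇒AllNew (nth d w) (length w) (subst Rich (sym (fw-nth d w)) rich)

  Rich? : A → Decidable (Rich {A = A})
  Rich? d w = map′ (subst Rich (fw-nth d w) ∘ AllNew⇒Rich (nth d w) (length w)) (Rich⇒AllNew-nth d)
                   (AllNew? (nth d w) (length w))

  other-letter : ∀ {x y : A} → x ≢ y → ∀ z → ∃[ t ] t ≢ z
  other-letter {x} {y} x≢y z with x ≟ᴬ z
  ... | yes refl = y , x≢y ∘ sym
  ... | no x≢z   = x , x≢z

  short-K : ∀ {x y : A} → x ≢ y → ∀ {w} → Rich w → 0 < length w → ∃[ u ] K w u × length u ≤ length w
  short-K {x} x≢y {w} rich 0<n
    with t , t≢ ← other-letter x≢y (nth x w 0)
    with g , i , g≡f , n≤i , i≤2n , allg , h , h≡g , hi≢gi , allh ← branching t≢ 0<n (Rich⇒AllNew-nth x rich)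
    with m , refl ← m≤n⇒∃[o]m+o≡n n≤i =
      -- u runs along `g` from `n` to the branching position `n + m`, where `g` and `h` supply the
      -- two letters.
      fw g n m
    , ( subst Rich (sym w++u) (AllNew⇒Rich g (n + m) (AllNew-≤ (n≤1+n (n + m)) allg))
      , g (n + m) , h (n + m) , hi≢gi ∘ sym
      , subst Rich (trans (fw-∷ʳ g 0 (n + m)) (cong (_∷ʳ g (n + m)) (sym w++u))) (AllNew⇒Rich g (suc (n + m)) allg)
      , subst Rich (trans (fw-∷ʳ h 0 (n + m)) (cong (_∷ʳ h (n + m)) (trans (fw-cong h g 0 0 (n + m) h≡g) (sym w++u))))
          (AllNew⇒Rich h (suc (n + m)) allh) )
    , subst (_≤ n) (sym (length-fw g n m)) (+-cancelˡ-≤ n m n i≤2n)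
    where
    n = length w
    w++u : w ++ fw g n m ≡ fw g 0 (n + m)
    w++u = sym (trans (fw-++ g 0 n m) (cong (_++ fw g n m) (trans (fw-cong g (nth x w) 0 0 n g≡f) (fw-nth x w))))

-- Minimum and maximum over a finite alphabet

module Maximum {a} {A : Set a} {q : ℕ} (A↔Fin : A ↔ Fin q) {x y : A} (x≢y : x ≢ y) where

  _≟ᴬ_ : DecidableEquality A
  _≟ᴬ_ = via-injection (↔⇒↣ A↔Fin) Fin._≟_

  open Words _≟ᴬ_

  any-letter? : ∀ {p} {P : A → Set p} → Decidable P → Dec (∃ P)
  any-letter? {P = P} P? = map′
    (λ (i , Pi) → Inverse.from A↔Fin i , Pi)
    (λ (z , Pz) → Inverse.to A↔Fin z , subst P (sym (Inverse.strictlyInverseʳ A↔Fin z)) Pz)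
    (Fin.any? (P? ∘ Inverse.from A↔Fin))

  any-word? : ∀ {p} l {P : List A → Set p} → Decidable P → Dec (∃[ u ] P u × length u ≡ l)
  any-word? zero P? = map′ (λ P[] → [] , P[] , refl) (λ { ([] , P[] , refl) → P[] }) (P? [])
  any-word? (suc l) P? = map′
    (λ (z , u , Pzu , eq) → z ∷ u , Pzu , cong suc eq)
    (λ { (z ∷ u , Pzu , refl) → z , u , Pzu , refl })
    (any-letter? λ z → any-word? l (P? ∘ (z ∷_)))

  ExtendsInTwoWays? : Decidable (ExtendsInTwoWays {A = A})
  ExtendsInTwoWays? w = any-letter? λ s → any-letter? λ t →
    ¬? (s ≟ᴬ t) ×-dec Rich? x (w ∷ʳ s) ×-dec Rich? x (w ∷ʳ t)

  K? : ∀ w → Decidable (K w)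
  K? w u = Rich? x (w ++ u) ×-dec ExtendsInTwoWays? (w ++ u)

  HasShortω : ℕ → List A → Set a
  HasShortω n w = ∃[ k ] ω[ w ]≡ k × k ≤ n

  -- An element of `K w` from `short-K` bounds the search for the least length.
  ω-exists : ∀ {w : List A} → Rich w → 0 < length w → HasShortω (length w) w
  ω-exists {w} rich 0<n = minimal (short-K x≢y rich 0<n)
    where
    Length : ℕ → Set a
    Length l = ∃[ u ] K w u × length u ≡ l
    conclude : ∀ {m} → m ≤ length w → ∃ (Least Length m) → HasShortω (length w) w
    conclude m≤n (k , k≤m , Pk , min) = k , (Pk , λ l Pl → ≮⇒≥ λ l<k → min l l<k Pl) , ≤-trans k≤m m≤n
    minimal : ∃[ u ] K w u × length u ≤ length w → HasShortω (length w) w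
    minimal (u , Ku , u≤n) = conclude u≤n (least {P = Length} (λ l → any-word? l (K? w)) (length u) (u , Ku , refl))

  ω-unique : ∀ {w : List A} {k l} → ω[ w ]≡ k → ω[ w ]≡ l → k ≡ l
  ω-unique (Pk , mink) (Pl , minl) = ≤-antisym (mink _ Pl) (minl _ Pk)

  Attains : ℕ → ℕ → List A → Set a
  Attains n m w = Rich w × length w ≡ n × ω[ w ]≡ m

  -- For a rich word of length `n`, ω exists and is unique, so the question becomes an equality of
  -- numbers.
  Attains? : ∀ {n} → 0 < n → ∀ m → Decidable (Attains n m)
  Attains? {n} 0<n m w = decide (Rich? x w) (length w ≟ n)
    where
    decide-ω : Rich w → length w ≡ n → HasShortω (length w) w → Dec (Attains n m w)
    decide-ω rich len (k , ωk , _) =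
      map′ (λ k≡m → rich , len , subst (ω[ w ]≡_) k≡m ωk) (λ (_ , _ , ωm) → ω-unique ωk ωm) (k ≟ m)
    decide : Dec (Rich w) → Dec (length w ≡ n) → Dec (Attains n m w)
    decide (no ¬rich) _          = no (¬rich ∘ proj₁)
    decide (yes _)    (no len≢)  = no (len≢ ∘ proj₁ ∘ proj₂)
    decide (yes rich) (yes len)  = decide-ω rich len (ω-exists rich (subst (0 <_) (sym len) 0<n))

  φ-exists : ∀ n → 0 < n → ∃[ m ] (φ[ A , n ]≡ m) × m ≤ n
  -- A constant word is rich, so some value is attained; all values are at most `n`, so a greatest
  -- one is found below `suc n`.
  φ-exists n 0<n = maximal (attained rich₀ len₀)
    where
    w₀ : List A
    w₀ = fw (λ _ → x) 0 n
    len₀ : length w₀ ≡ n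
    len₀ = length-fw (λ _ → x) 0 n
    rich₀ : Rich w₀
    rich₀ = AllNew⇒Rich (λ _ → x) n λ _ _ → 0 , z≤n , (λ _ _ _ _ _ → refl) , λ _ _ ()
    Value : ℕ → Set a
    Value m = ∃[ w ] Attains n m w × length w ≡ n
    attained : ∀ {w} → Rich w → length w ≡ n → HasShortω n w
    attained {w} rich len =
      subst (λ n → HasShortω n w) len (ω-exists rich (subst (0 <_) (sym len) 0<n))
    conclude : ∃ (Greatest Value (suc n)) → ∃[ m ] (φ[ A , n ]≡ m) × m ≤ n
    conclude (m , m<sn , (w , att , _) , last) = m , ((w , att) , bound) , s≤s⁻¹ m<sn
      where
      bounded : ∀ {w} → Rich w → length w ≡ n → HasShortω n w → ∃[ k ] ω[ w ]≡ k × k ≤ m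
      bounded {w} rich len (k , ωk , k≤n) =
        k , ωk , ≮⇒≥ λ m<k → last k m<k (s≤s k≤n) (w , (rich , len , ωk) , len)
      bound : ∀ w → Rich w → length w ≡ n → ∃[ k ] ω[ w ]≡ k × k ≤ m
      bound w rich len = bounded rich len (attained rich len)
    maximal : HasShortω n w₀ → ∃[ m ] (φ[ A , n ]≡ m) × m ≤ n
    maximal (k , ωk , k≤n) = conclude
      (greatest {P = Value} (λ m → any-word? n (Attains? 0<n m)) (suc n) {k} (s≤s k≤n) (w₀ , (rich₀ , len₀ , ωk) , len₀))

corollary4p9 : ∀ {a} {A : Set a} {q : ℕ} → A ↔ Fin q → 2 ≤ q →
    ∀ (n : ℕ) → 1 ≤ n → ∃[ m ] (φ[ A , n ]≡ m) × m ≤ n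
corollary4p9 {q = suc (suc _)} A↔Fin _ = Maximum.φ-exists A↔Fin {from Fin.zero} {from (Fin.suc Fin.zero)} distinct
  where
  open Inverse A↔Fin using (to; from; strictlyInverseˡ)
  distinct : from Fin.zero ≢ from (Fin.suc Fin.zero)
  distinct eq with () ← trans (sym (strictlyInverseˡ Fin.zero)) (trans (cong to eq) (strictlyInverseˡ (Fin.suc Fin.zero)))
corollary4p9 {q = suc zero} _ (s≤s ())
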